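{- For every integer $k>2$, $N(2k+6,k)=2$ if $k\equiv1\pmod 3$ and $N(2k+6,k)=0$ if $k\not\equiv1\pmod3$.
   Context: For $n>k\ge1$, $N(n,k)$ is the nullity of the $n\times n$ skew-symmetric Toeplitz matrix $A(n,k)$ whose first $k$ superdiagonals have all entries $1$ and whose remaining superdiagonals have all entries $0$. -}

module Defs where

open import Data.Bool.Base using (if_then_else_)
open import Data.Fin.Base using (Fin; toℕ)
open import Data.Nat.Base using (ℕ; _∸_; _<ᵇ_; _≤ᵇ_)
open import Data.Rational.Base using (ℚ; 0ℚ; 1ℚ; _*_; -_)
open import Data.Rational.Properties using (+-0-monoid)
open import Data.Vec.Functional using (Vector)
open import Relation.Binary.PropositionalEquality.Core using (_≡_)

open import Algebra.Properties.Monoid.Sum +-0-monoid using (sum-syntax)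

Matrix : ℕ → ℕ → Set
Matrix m n = Fin m → Fin n → ℚ

-- c d is the common entry of the d-th superdiagonal (d ≥ 1); c 0 is not used.
skewToeplitz : (n : ℕ) → (ℕ → ℚ) → Matrix n n
skewToeplitz n c i j =
  if toℕ i <ᵇ toℕ j then c (toℕ j ∸ toℕ i)
  else if toℕ j <ᵇ toℕ i then - c (toℕ i ∸ toℕ j)
  else 0ℚ

A : (n k : ℕ) → Matrix n n
A n k = skewToeplitz n (λ d → if d ≤ᵇ k then 1ℚ else 0ℚ)

infixr 7 _·_

_·_ : ∀ {m n} → Matrix m n → Vector ℚ n → Vector ℚ m
_·_ {n = n} M x i = ∑[ j < n ] (M i j * x j)

InKernel : ∀ {m n} → Matrix m n → Vector ℚ n → Set
InKernel M x = ∀ i → (M · x) i ≡ 0ℚ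

combination : ∀ {d n} → Vector ℚ d → (Fin d → Vector ℚ n) → Vector ℚ n
combination {d} c v j = ∑[ l < d ] (c l * v l j)

LinearlyIndependent : ∀ {d n} → (Fin d → Vector ℚ n) → Set
LinearlyIndependent {d} v =
  (c : Vector ℚ d) → (∀ j → combination c v j ≡ 0ℚ) → ∀ l → c l ≡ 0ℚ

record Spans {d n} (v : Fin d → Vector ℚ n) (x : Vector ℚ n) : Set where
  field
    coefficients : Vector ℚ d
    equation     : ∀ j → x j ≡ combination coefficients v j

-- The kernel of M has a basis of d vectors, i.e. dim (ker M) = d.  The scalars
-- are ℚ; the nullity of a rational matrix does not change on passing to a
-- larger field such as ℝ or ℂ.
record HasNullity {m n} (M : Matrix m n) (d : ℕ) : Set where
  field
    basis       : Fin d → Vector ℚ n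
    inKernel    : ∀ l → InKernel M (basis l)
    independent : LinearlyIndependent basis
    spanning    : ∀ x → InKernel M x → Spans basis x

{-# OPTIONS --safe #-}
-- Let P m be the sum of the first m entries of x, with P constant outside
-- [0, n].  Row i of A n k · x = 0 reads
-- P (i + k + 1) + P (i − k) = P i + P (i + 1).  For n = 2k + 6 the rows i ≤ k
-- express P on [k + 1, 2k + 1] through P on [0, k + 1], and the remaining rows
-- then force P 3 = P 4 = P k = 0, P 5 = P (k + 1) = P 1, P n = P 1 + P 2, and that
-- any three consecutive values among P 4, …, P (k + 1) add up to P n.  Hence
-- P 4, P 5, … runs through 0, P 1, P 2 with period 3, and P k = 0,
-- P (k + 1) = P 1 hold for free when k ≡ 1 (mod 3) and force P 1 = P 2 = 0
-- otherwise.  (For k = 3, where P 5 = P 1 is not forced, P 4 = P (k + 1) = P 1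
-- already gives P 1 = 0, and then P 2 = 0.)
module Submission where

open import Defs
open import Data.Nat.Base using (ℕ; _+_; _*_; _>_; _%_)
open import Data.Product.Base using (_×_)
open import Relation.Binary.PropositionalEquality.Core using (_≡_; _≢_)

open import Data.Bool.Base using (true; false; T; if_then_else_)
open import Data.Empty using (⊥-elim)
open import Data.Fin.Base as Fin using (Fin; toℕ; fromℕ<)
open import Data.Fin.Properties using (toℕ-fromℕ<; toℕ<n)
open import Data.List.Base using ([]; _∷_)
open import Data.Nat.Base using (zero; suc; _∸_; _≤_; _<_; _<ᵇ_; _≤ᵇ_; z≤n; s≤s)
open import Data.Nat.DivMod using ([m+n]%n≡m%n)
open import Data.Nat.Induction using (<-rec)
import Data.Nat.Properties as ℕₚ
open import Data.Nat.Tactic.RingSolver using () renaming (solve to ℕ-solve)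
open import Data.Product.Base using (_,_; proj₁; proj₂; ∃-syntax)
open import Data.Rational.Base as ℚ using (ℚ; 0ℚ; 1ℚ)
import Data.Rational.Properties as ℚₚ
open import Data.Sum.Base using (_⊎_; inj₁; inj₂)
open import Data.Vec.Functional using (Vector; tail)
open import Function.Base using (_∘_)
open import Level using (0ℓ)
open import Relation.Binary.Definitions using (tri<; tri≈; tri>)
open import Relation.Binary.PropositionalEquality using (refl; sym; trans; cong; cong₂; subst; subst₂; module ≡-Reasoning)
open import Relation.Nullary using (¬_; yes; no)
open import Relation.Nullary.Decidable.Core using (dec⇒maybe)
open import Tactic.RingSolver using (solve)
open import Tactic.RingSolver.Core.AlmostCommutativeRing using (AlmostCommutativeRing; fromCommutativeRing)

open import Algebra.Properties.Group ℚₚ.+-0-group using (∙-cancelʳ; x∙y⁻¹≈ε⇒x≈y; x≈y⇒x∙y⁻¹≈ε)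
open import Algebra.Properties.Monoid.Sum ℚₚ.+-0-monoid using (sum-syntax; sum-cong-≗)

-- Equational reasoning over the rationals and case splits on an index

ℚ-ring : AlmostCommutativeRing 0ℓ 0ℓ
ℚ-ring = fromCommutativeRing ℚₚ.+-*-commutativeRing (λ q → dec⇒maybe (0ℚ ℚₚ.≟ q))

infixl 6 _⊕_

_⊕_ : ∀ {p q r s : ℚ} → p ≡ q → r ≡ s → p ℚ.+ r ≡ q ℚ.+ s
_⊕_ = cong₂ ℚ._+_

-- l = r follows from hypotheses adding up to p = q once l − r = p − q is a ring
-- identity.
from-hypotheses : ∀ {p q l r : ℚ} → p ≡ q → l ℚ.+ q ≡ r ℚ.+ p → l ≡ r
from-hypotheses {p} {l = l} {r} refl = ∙-cancelʳ p l r

≤-or-beyond : ∀ b m → m ≤ b ⊎ ∃[ s ] m ≡ suc b + s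
≤-or-beyond b m with m ℕₚ.≤? b
... | yes m≤b = inj₁ m≤b
... | no  m≰b = inj₂ (m ∸ suc b , sym (ℕₚ.m+[n∸m]≡n (ℕₚ.≰⇒> m≰b)))

-- Partial sums

-- The argument is any natural number, not a bounded index: the row equations reach past `n`, where
-- the sum stays constant.
partialSum : ∀ {n} → Vector ℚ n → ℕ → ℚ
partialSum         x zero    = 0ℚ
partialSum {zero}  x (suc m) = 0ℚ
partialSum {suc n} x (suc m) = x Fin.zero ℚ.+ partialSum (tail x) m

partialSum-suc : ∀ {n} (x : Vector ℚ n) j →
                 partialSum x (suc (toℕ j)) ≡ x j ℚ.+ partialSum x (toℕ j)
partialSum-suc x Fin.zero    = refl
partialSum-suc x (Fin.suc j) = from-hypotheses (partialSum-suc (tail x) j)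
  (lemma (x Fin.zero) (x (Fin.suc j)) (partialSum (tail x) (suc (toℕ j))) (partialSum (tail x) (toℕ j)))
  where
  lemma : ∀ x₀ xⱼ s s′ → x₀ ℚ.+ s ℚ.+ (xⱼ ℚ.+ s′) ≡ xⱼ ℚ.+ (x₀ ℚ.+ s′) ℚ.+ s
  lemma x₀ xⱼ s s′ = solve (x₀ ∷ xⱼ ∷ s ∷ s′ ∷ []) ℚ-ring

partialSum-beyond : ∀ {n} (x : Vector ℚ n) m → partialSum x (n + m) ≡ partialSum x n
partialSum-beyond {zero}  x zero    = refl
partialSum-beyond {zero}  x (suc m) = refl
partialSum-beyond {suc n} x m       = cong (x Fin.zero ℚ.+_) (partialSum-beyond (tail x) m)

increments : ∀ n → (ℕ → ℚ) → Vector ℚ n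
increments n P j = P (suc (toℕ j)) ℚ.- P (toℕ j)

partialSum-increments : ∀ n P {m} → m ≤ n → partialSum (increments n P) m ℚ.+ P 0 ≡ P m
partialSum-increments n       P z≤n               = ℚₚ.+-identityˡ (P 0)
partialSum-increments (suc n) P {suc m} (s≤s m≤n) =
  from-hypotheses (partialSum-increments n (P ∘ suc) m≤n)
    (lemma (P 0) (P 1) (partialSum (increments n (P ∘ suc)) m) (P (suc m)))
  where
  lemma : ∀ p₀ p₁ s p → (p₁ ℚ.- p₀ ℚ.+ s ℚ.+ p₀) ℚ.+ p ≡ p ℚ.+ (s ℚ.+ p₁)
  lemma p₀ p₁ s p = solve (p₀ ∷ p₁ ∷ s ∷ p ∷ []) ℚ-ring

below : ℕ → ℕ → ℚ
below m j = if j <ᵇ m then 1ℚ else 0ℚ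

∑-below : ∀ {n} (x : Vector ℚ n) m →
          ∑[ j < n ] (below m (toℕ j) ℚ.* x j) ≡ partialSum x m
∑-below {zero}  x zero    = refl
∑-below {zero}  x (suc m) = refl
∑-below {suc n} x zero    = cong₂ ℚ._+_ (ℚₚ.*-zeroˡ (x Fin.zero)) (∑-below (tail x) zero)
∑-below {suc n} x (suc m) = cong₂ ℚ._+_ (ℚₚ.*-identityˡ (x Fin.zero)) (∑-below (tail x) m)

∑-distrib : ∀ {n} (a b c d x : Vector ℚ n) →
  ∑[ j < n ] ((a j ℚ.+ b j ℚ.- (c j ℚ.+ d j)) ℚ.* x j) ≡
  ∑[ j < n ] (a j ℚ.* x j) ℚ.+ ∑[ j < n ] (b j ℚ.* x j)
    ℚ.- (∑[ j < n ] (c j ℚ.* x j) ℚ.+ ∑[ j < n ] (d j ℚ.* x j))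
∑-distrib {zero}  a b c d x = refl
∑-distrib {suc n} a b c d x = trans
  (cong ((a Fin.zero ℚ.+ b Fin.zero ℚ.- (c Fin.zero ℚ.+ d Fin.zero)) ℚ.* x Fin.zero ℚ.+_)
        (∑-distrib (tail a) (tail b) (tail c) (tail d) (tail x)))
  (lemma (a Fin.zero) (b Fin.zero) (c Fin.zero) (d Fin.zero) (x Fin.zero) _ _ _ _)
  where
  lemma : ∀ a b c d x α β γ δ →
    (a ℚ.+ b ℚ.- (c ℚ.+ d)) ℚ.* x ℚ.+ (α ℚ.+ β ℚ.- (γ ℚ.+ δ)) ≡
    a ℚ.* x ℚ.+ α ℚ.+ (b ℚ.* x ℚ.+ β) ℚ.- (c ℚ.* x ℚ.+ γ ℚ.+ (d ℚ.* x ℚ.+ δ))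
  lemma a b c d x α β γ δ = solve (a ∷ b ∷ c ∷ d ∷ x ∷ α ∷ β ∷ γ ∷ δ ∷ []) ℚ-ring

-- Rows of A

T⇒≡true : ∀ {b} → T b → b ≡ true
T⇒≡true {true} _ = refl

¬T⇒≡false : ∀ {b} → ¬ T b → b ≡ false
¬T⇒≡false {true}  ¬t = ⊥-elim (¬t _)
¬T⇒≡false {false} _  = refl

<ᵇ-true : ∀ {m n} → m < n → (m <ᵇ n) ≡ true
<ᵇ-true m<n = T⇒≡true (ℕₚ.<⇒<ᵇ m<n)

<ᵇ-false : ∀ {m n} → n ≤ m → (m <ᵇ n) ≡ false
<ᵇ-false {m} {n} n≤m = ¬T⇒≡false (λ t → ℕₚ.≤⇒≯ n≤m (ℕₚ.<ᵇ⇒< m n t))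

≤ᵇ-true : ∀ {m n} → m ≤ n → (m ≤ᵇ n) ≡ true
≤ᵇ-true m≤n = T⇒≡true (ℕₚ.≤⇒≤ᵇ m≤n)

≤ᵇ-false : ∀ {m n} → n < m → (m ≤ᵇ n) ≡ false
≤ᵇ-false {m} {n} n<m = ¬T⇒≡false (λ t → ℕₚ.<⇒≱ n<m (ℕₚ.≤ᵇ⇒≤ m n t))

m∸n≤o⇒m≤n+o : ∀ m n {o} → m ∸ n ≤ o → m ≤ n + o
m∸n≤o⇒m≤n+o m n m∸n≤o = ℕₚ.≤-trans (ℕₚ.m≤n+m∸n m n) (ℕₚ.+-monoʳ-≤ n m∸n≤o)

-- Row `i` is 1 on `(i, i + k]`, the difference of the indicators `below (i + k + 1)` and
-- `below (i + 1)`, and -1 on `[i - k, i)`, the negated difference of `below i` and `below (i - k)`.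
-- For `i ≤ k` truncated subtraction lets the second interval start at 0.
A-entry : ∀ {n} k (i j : Fin n) →
  A n k i j ≡ below (toℕ i + suc k) (toℕ j) ℚ.+ below (toℕ i ∸ k) (toℕ j)
              ℚ.- (below (toℕ i) (toℕ j) ℚ.+ below (suc (toℕ i)) (toℕ j))
A-entry k i j = go (toℕ i) (toℕ j)
  where
  go : ∀ i j →
    (if i <ᵇ j then (if j ∸ i ≤ᵇ k then 1ℚ else 0ℚ)
     else if j <ᵇ i then ℚ.- (if i ∸ j ≤ᵇ k then 1ℚ else 0ℚ)
     else 0ℚ)
    ≡ below (i + suc k) j ℚ.+ below (i ∸ k) j ℚ.- (below i j ℚ.+ below (suc i) j)
  go i j with ℕₚ.<-cmp i j
  go i j | tri< i<j _ _ with j ∸ i ℕₚ.≤? k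
  ... | yes j∸i≤k
    rewrite <ᵇ-true i<j | ≤ᵇ-true j∸i≤k
          | <ᵇ-true (ℕₚ.≤-trans (s≤s (m∸n≤o⇒m≤n+o j i j∸i≤k)) (ℕₚ.≤-reflexive (sym (ℕₚ.+-suc i k))))
          | <ᵇ-false (ℕₚ.≤-trans (ℕₚ.m∸n≤m i k) (ℕₚ.<⇒≤ i<j))
          | <ᵇ-false (ℕₚ.<⇒≤ i<j) | <ᵇ-false i<j = refl
  ... | no j∸i≰k
    rewrite <ᵇ-true i<j | ≤ᵇ-false (ℕₚ.≰⇒> j∸i≰k)
          | <ᵇ-false (subst (i + suc k ≤_) (ℕₚ.m+[n∸m]≡n (ℕₚ.<⇒≤ i<j)) (ℕₚ.+-monoʳ-≤ i (ℕₚ.≰⇒> j∸i≰k)))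
          | <ᵇ-false (ℕₚ.≤-trans (ℕₚ.m∸n≤m i k) (ℕₚ.<⇒≤ i<j))
          | <ᵇ-false (ℕₚ.<⇒≤ i<j) | <ᵇ-false i<j = refl
  go i j | tri≈ _ refl _
    rewrite <ᵇ-false (ℕₚ.≤-refl {i}) | <ᵇ-true (ℕₚ.m<m+n i (s≤s (z≤n {k})))
          | <ᵇ-false (ℕₚ.m∸n≤m i k) | <ᵇ-true (ℕₚ.n<1+n i) = refl
  go i j | tri> _ _ j<i with i ∸ j ℕₚ.≤? k
  ... | yes i∸j≤k
    rewrite <ᵇ-false (ℕₚ.<⇒≤ j<i) | <ᵇ-true j<i | ≤ᵇ-true i∸j≤k
          | <ᵇ-true (ℕₚ.<-≤-trans j<i (ℕₚ.m≤m+n i (suc k)))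
          | <ᵇ-false (ℕₚ.m≤n+o⇒m∸n≤o i k (subst (i ≤_) (ℕₚ.+-comm j k) (m∸n≤o⇒m≤n+o i j i∸j≤k)))
          | <ᵇ-true (ℕₚ.<-trans j<i (ℕₚ.n<1+n i)) = refl
  ... | no i∸j≰k
    rewrite <ᵇ-false (ℕₚ.<⇒≤ j<i) | <ᵇ-true j<i | ≤ᵇ-false (ℕₚ.≰⇒> i∸j≰k)
          | <ᵇ-true (ℕₚ.<-≤-trans j<i (ℕₚ.m≤m+n i (suc k)))
          | <ᵇ-true (ℕₚ.m+n≤o⇒m≤o∸n (suc j) (subst (suc j + k ≤_) (ℕₚ.m+[n∸m]≡n (ℕₚ.<⇒≤ j<i))
              (subst (_≤ j + (i ∸ j)) (ℕₚ.+-suc j k) (ℕₚ.+-monoʳ-≤ j (ℕₚ.≰⇒> i∸j≰k)))))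
          | <ᵇ-true (ℕₚ.<-trans j<i (ℕₚ.n<1+n i)) = refl

A-row : ∀ {n} k (x : Vector ℚ n) i → let P = partialSum x in
  (A n k · x) i ≡ P (toℕ i + suc k) ℚ.+ P (toℕ i ∸ k) ℚ.- (P (toℕ i) ℚ.+ P (suc (toℕ i)))
A-row {n} k x i = begin
  (A n k · x) i
    ≡⟨ sum-cong-≗ (λ j → cong (ℚ._* x j) (A-entry k i j)) ⟩
  _
    ≡⟨ ∑-distrib (below (toℕ i + suc k) ∘ toℕ) (below (toℕ i ∸ k) ∘ toℕ)
                 (below (toℕ i) ∘ toℕ) (below (suc (toℕ i)) ∘ toℕ) x ⟩
  _
    ≡⟨ cong₂ ℚ._-_ (∑-below x (toℕ i + suc k) ⊕ ∑-below x (toℕ i ∸ k))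
                   (∑-below x (toℕ i) ⊕ ∑-below x (suc (toℕ i))) ⟩
  _ ∎
  where open ≡-Reasoning

-- The recurrence

-- The rows of A (2k + 6) k in terms of partial sums, split at i = k so that no
-- index i − k is negative: early is row i, late is row k + 1 + r.
record Solution (k : ℕ) (P : ℕ → ℚ) : Set where
  field
    origin : P 0 ≡ 0ℚ
    early  : ∀ i → i ≤ k → P (suc k + i) ≡ P i ℚ.+ P (suc i)
    late   : ∀ r → r < 5 + k →
             P (suc k + (suc k + r)) ℚ.+ P (suc r) ≡ P (suc k + r) ℚ.+ P (suc k + suc r)
    final  : ∀ r → P (suc k + (suc k + (4 + r))) ≡ P (suc k + (suc k + 4))

2k+6≡1+k+[5+k] : ∀ k → 2 * k + 6 ≡ suc k + (5 + k)
2k+6≡1+k+[5+k] k = ℕ-solve (k ∷ [])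

2k+6≡1+k+[1+k+4] : ∀ k → 2 * k + 6 ≡ suc k + (suc k + 4)
2k+6≡1+k+[1+k+4] k = ℕ-solve (k ∷ [])

1+k+r∸k≡1+r : ∀ k r → suc k + r ∸ k ≡ suc r
1+k+r∸k≡1+r k r = trans (cong (_∸ k) (sym (ℕₚ.+-suc k r))) (ℕₚ.m+n∸m≡n k (suc r))

inKernel⇒solution : ∀ k (x : Vector ℚ (2 * k + 6)) →
                    InKernel (A (2 * k + 6) k) x → Solution k (partialSum x)
inKernel⇒solution k x Ax≡0 = record
  { origin = refl
  ; early  = λ i i≤k → begin
      P (suc k + i)                  ≡⟨ cong P (ℕₚ.+-comm (suc k) i) ⟩
      -- The term `P (i ∸ k)` of the row is free to insert: `i ∸ k` is 0 for `i ≤ k`, and `P 0`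
      -- reduces to `0ℚ`.
      P (i + suc k)                  ≡⟨ ℚₚ.+-identityʳ _ ⟨
      P (i + suc k) ℚ.+ P 0          ≡⟨ cong (λ m → P (i + suc k) ℚ.+ P m) (ℕₚ.m≤n⇒m∸n≡0 i≤k) ⟨
      P (i + suc k) ℚ.+ P (i ∸ k)    ≡⟨ row i (subst (i <_) (sym (2k+6≡1+k+[5+k] k)) (s≤s (ℕₚ.≤-trans i≤k (ℕₚ.m≤m+n k (5 + k))))) ⟩
      P i ℚ.+ P (suc i)              ∎
  ; late   = λ r r<5+k → begin
      P (suc k + (suc k + r)) ℚ.+ P (suc r)
        ≡⟨ cong₂ (λ m m′ → P m ℚ.+ P m′) (ℕₚ.+-comm (suc k) (suc k + r)) (sym (1+k+r∸k≡1+r k r)) ⟩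
      P (suc k + r + suc k) ℚ.+ P (suc k + r ∸ k)
        ≡⟨ row (suc k + r) (subst (suc k + r <_) (sym (2k+6≡1+k+[5+k] k)) (ℕₚ.+-monoʳ-< (suc k) r<5+k)) ⟩
      P (suc k + r) ℚ.+ P (suc (suc k + r))
        ≡⟨ cong (λ m → P (suc k + r) ℚ.+ P m) (ℕₚ.+-suc (suc k) r) ⟨
      P (suc k + r) ℚ.+ P (suc k + suc r) ∎
  ; final  = λ r → begin
      P (suc k + (suc k + (4 + r)))  ≡⟨ cong P (trans (regroup r) (cong (_+ r) (sym (2k+6≡1+k+[1+k+4] k)))) ⟩
      P (2 * k + 6 + r)              ≡⟨ partialSum-beyond x r ⟩
      P (2 * k + 6)                  ≡⟨ cong P (2k+6≡1+k+[1+k+4] k) ⟩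
      P (suc k + (suc k + 4))        ∎
  }
  where
  open ≡-Reasoning
  P : ℕ → ℚ
  P = partialSum x
  regroup : ∀ r → suc k + (suc k + (4 + r)) ≡ suc k + (suc k + 4) + r
  regroup r = ℕ-solve (k ∷ r ∷ [])
  row : ∀ i → i < 2 * k + 6 → P (i + suc k) ℚ.+ P (i ∸ k) ≡ P i ℚ.+ P (suc i)
  row i i<n = subst (λ i → P (i + suc k) ℚ.+ P (i ∸ k) ≡ P i ℚ.+ P (suc i)) (toℕ-fromℕ< i<n)
    (x∙y⁻¹≈ε⇒x≈y _ _ (trans (sym (A-row k x (fromℕ< i<n))) (Ax≡0 (fromℕ< i<n))))

-- The partial sums of the increments are `P` again: up to `n` because of `origin`, beyond `n`
-- because `final` keeps `P` constant there. The rows are then `early` and `late`.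
solution⇒inKernel : ∀ k P → Solution k P →
                    InKernel (A (2 * k + 6) k) (increments (2 * k + 6) P)
solution⇒inKernel k P sol i = begin
  (A n k · increments n P) i
    ≡⟨ A-row k (increments n P) i ⟩
  S (toℕ i + suc k) ℚ.+ S (toℕ i ∸ k) ℚ.- (S (toℕ i) ℚ.+ S (suc (toℕ i)))
    ≡⟨ cong₂ ℚ._-_ (S≗P (toℕ i + suc k) ⊕ S≗P (toℕ i ∸ k)) (S≗P (toℕ i) ⊕ S≗P (suc (toℕ i))) ⟩
  P (toℕ i + suc k) ℚ.+ P (toℕ i ∸ k) ℚ.- (P (toℕ i) ℚ.+ P (suc (toℕ i)))
    ≡⟨ x≈y⇒x∙y⁻¹≈ε (row (toℕ i) (toℕ<n i)) ⟩
  0ℚ ∎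
  where
  open ≡-Reasoning
  open Solution sol
  n : ℕ
  n = 2 * k + 6
  S : ℕ → ℚ
  S = partialSum (increments n P)
  S≗P-≤ : ∀ {m} → m ≤ n → S m ≡ P m
  S≗P-≤ {m} m≤n = begin
    S m          ≡⟨ ℚₚ.+-identityʳ (S m) ⟨
    S m ℚ.+ 0ℚ   ≡⟨ cong (S m ℚ.+_) origin ⟨
    S m ℚ.+ P 0  ≡⟨ partialSum-increments n P m≤n ⟩
    P m          ∎
  P-beyond : ∀ r → P (n + r) ≡ P n
  P-beyond r = begin
    P (n + r)                      ≡⟨ cong P (regroup r) ⟩
    P (suc k + (suc k + (4 + r)))  ≡⟨ final r ⟩
    P (suc k + (suc k + 4))        ≡⟨ cong P (2k+6≡1+k+[1+k+4] k) ⟨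
    P n                            ∎
    where
    regroup : ∀ r → 2 * k + 6 + r ≡ suc k + (suc k + (4 + r))
    regroup r = ℕ-solve (k ∷ r ∷ [])
  S≗P : ∀ m → S m ≡ P m
  S≗P m with ≤-or-beyond n m
  ... | inj₁ m≤n        = S≗P-≤ m≤n
  ... | inj₂ (s , refl) = begin
    S (suc n + s)  ≡⟨ cong S (ℕₚ.+-suc n s) ⟨
    S (n + suc s)  ≡⟨ partialSum-beyond (increments n P) (suc s) ⟩
    S n            ≡⟨ S≗P-≤ ℕₚ.≤-refl ⟩
    P n            ≡⟨ P-beyond (suc s) ⟨
    P (n + suc s)  ≡⟨ cong P (ℕₚ.+-suc n s) ⟩
    P (suc n + s)  ∎
  row : ∀ i → i < n → P (i + suc k) ℚ.+ P (i ∸ k) ≡ P i ℚ.+ P (suc i)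
  row i i<n with ≤-or-beyond k i
  ... | inj₁ i≤k = begin
    P (i + suc k) ℚ.+ P (i ∸ k)  ≡⟨ cong₂ (λ m m′ → P m ℚ.+ P m′) (ℕₚ.+-comm i (suc k)) (ℕₚ.m≤n⇒m∸n≡0 i≤k) ⟩
    P (suc k + i) ℚ.+ P 0        ≡⟨ early i i≤k ⊕ origin ⟩
    P i ℚ.+ P (suc i) ℚ.+ 0ℚ     ≡⟨ ℚₚ.+-identityʳ _ ⟩
    P i ℚ.+ P (suc i)            ∎
  ... | inj₂ (r , refl) = begin
    P (suc k + r + suc k) ℚ.+ P (suc k + r ∸ k)
      ≡⟨ cong₂ (λ m m′ → P m ℚ.+ P m′) (ℕₚ.+-comm (suc k + r) (suc k)) (1+k+r∸k≡1+r k r) ⟩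
    P (suc k + (suc k + r)) ℚ.+ P (suc r)
      ≡⟨ late r (ℕₚ.+-cancelˡ-< (suc k) r (5 + k) (subst (suc k + r <_) (2k+6≡1+k+[5+k] k) i<n)) ⟩
    P (suc k + r) ℚ.+ P (suc k + suc r)
      ≡⟨ cong (λ m → P (suc k + r) ℚ.+ P m) (ℕₚ.+-suc (suc k) r) ⟩
    P (suc k + r) ℚ.+ P (suc (suc k + r)) ∎

linear-combination : ∀ {k P Q} (α β : ℚ) → Solution k P → Solution k Q →
                     Solution k (λ m → α ℚ.* P m ℚ.+ β ℚ.* Q m)
linear-combination {k} {P} {Q} α β solP solQ = record
  { origin = trans (combine P.origin Q.origin) (zeros α β)
  ; early  = λ i i≤k → trans (combine (P.early i i≤k) (Q.early i i≤k)) (sums α β _ _ _ _)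
  ; late   = λ r r< → trans (sym (sums α β _ _ _ _))
                            (trans (combine (P.late r r<) (Q.late r r<)) (sums α β _ _ _ _))
  ; final  = λ r → combine (P.final r) (Q.final r)
  }
  where
  module P = Solution solP
  module Q = Solution solQ
  combine : ∀ {p p′ q q′} → p ≡ p′ → q ≡ q′ → α ℚ.* p ℚ.+ β ℚ.* q ≡ α ℚ.* p′ ℚ.+ β ℚ.* q′
  combine = cong₂ (λ p q → α ℚ.* p ℚ.+ β ℚ.* q)
  zeros : ∀ α β → α ℚ.* 0ℚ ℚ.+ β ℚ.* 0ℚ ≡ 0ℚ
  zeros α β = solve (α ∷ β ∷ []) ℚ-ring
  sums : ∀ α β p p′ q q′ → α ℚ.* (p ℚ.+ p′) ℚ.+ β ℚ.* (q ℚ.+ q′) ≡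
                           (α ℚ.* p ℚ.+ β ℚ.* q) ℚ.+ (α ℚ.* p′ ℚ.+ β ℚ.* q′)
  sums α β p p′ q q′ = solve (α ∷ β ∷ p ∷ p′ ∷ q ∷ q′ ∷ []) ℚ-ring

-- Consequences of the recurrence

-- With a, b, d and t for the values of P at r, k + 1 + r, 2k + 2 + r and 2k + 6.
module Forced
  {a₀ a₁ a₂ a₃ a₄ b₀ b₁ b₂ b₃ b₄ d₀ d₁ d₂ d₃ t : ℚ}
  (origin : a₀ ≡ 0ℚ)
  (early₀ : b₀ ≡ a₀ ℚ.+ a₁)
  (early₁ : b₁ ≡ a₁ ℚ.+ a₂)
  (early₂ : b₂ ≡ a₂ ℚ.+ a₃)
  (early₃ : b₃ ≡ a₃ ℚ.+ a₄)
  (late₀ : d₀ ℚ.+ a₁ ≡ b₀ ℚ.+ b₁)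
  (late₁ : d₁ ℚ.+ a₂ ≡ b₁ ℚ.+ b₂)
  (late₂ : d₂ ℚ.+ a₃ ≡ b₂ ℚ.+ b₃)
  (late₃ : d₃ ℚ.+ a₄ ≡ b₃ ℚ.+ b₄)
  (wrapped₀ : t ℚ.+ b₁ ≡ d₀ ℚ.+ d₁)
  (wrapped₁ : t ℚ.+ b₂ ≡ d₁ ℚ.+ d₂)
  (wrapped₂ : t ℚ.+ b₃ ≡ d₂ ℚ.+ d₃)
  (wrapped₃ : t ℚ.+ b₄ ≡ d₃ ℚ.+ t)
  where

  b₀≡a₁ : b₀ ≡ a₁
  b₀≡a₁ = from-hypotheses (early₀ ⊕ origin) (solve (a₀ ∷ a₁ ∷ b₀ ∷ []) ℚ-ring)

  d₀≡a₁+a₂ : d₀ ≡ a₁ ℚ.+ a₂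
  d₀≡a₁+a₂ = from-hypotheses (late₀ ⊕ b₀≡a₁ ⊕ early₁)
    (solve (a₁ ∷ a₂ ∷ b₀ ∷ b₁ ∷ d₀ ∷ []) ℚ-ring)

  -- In `wrapped₃` the value `t` cancels, so `d₃ = b₄`; then `late₃` gives `a₄ = b₃`, and `early₃`
  -- leaves `a₃ = 0`.
  a₃≡0 : a₃ ≡ 0ℚ
  a₃≡0 = sym (from-hypotheses (early₃ ⊕ wrapped₃ ⊕ late₃)
    (solve (a₃ ∷ a₄ ∷ b₃ ∷ b₄ ∷ d₃ ∷ t ∷ []) ℚ-ring))

  -- Since `d₀ = b₁`, `wrapped₀` says `t = d₁`, and `late₁` evaluates `d₁` as `b₁ + b₂ - a₂`.
  t≡a₁+a₂ : t ≡ a₁ ℚ.+ a₂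
  t≡a₁+a₂ = from-hypotheses (wrapped₀ ⊕ late₀ ⊕ late₁ ⊕ early₁ ⊕ early₂ ⊕ b₀≡a₁ ⊕ a₃≡0)
    (solve (a₁ ∷ a₂ ∷ a₃ ∷ b₀ ∷ b₁ ∷ b₂ ∷ d₀ ∷ d₁ ∷ t ∷ []) ℚ-ring)

  -- With `t = d₁`, `wrapped₁` becomes `b₂ = d₂`; `late₂` then gives `b₃ = a₃ = 0`, whence `a₄ = 0`
  -- by `early₃`.
  a₄≡0 : a₄ ≡ 0ℚ
  a₄≡0 = sym (from-hypotheses
    (wrapped₁ ⊕ late₁ ⊕ late₂ ⊕ early₁ ⊕ early₂ ⊕ early₃ ⊕ a₃≡0 ⊕ sym t≡a₁+a₂)
    (solve (a₁ ∷ a₂ ∷ a₃ ∷ a₄ ∷ b₁ ∷ b₂ ∷ b₃ ∷ d₁ ∷ d₂ ∷ t ∷ []) ℚ-ring))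

  -- Insert `d₃ = b₄` and `d₂ = a₂ + b₃` into `wrapped₂`: what remains is `t = a₂ + b₄`.
  b₄≡a₁ : b₄ ≡ a₁
  b₄≡a₁ = sym (from-hypotheses (wrapped₂ ⊕ late₂ ⊕ sym wrapped₃ ⊕ early₂ ⊕ sym t≡a₁+a₂)
    (solve (a₁ ∷ a₂ ∷ a₃ ∷ b₂ ∷ b₃ ∷ b₄ ∷ d₂ ∷ d₃ ∷ t ∷ []) ℚ-ring))

-- These are the last four rows, `late` at `r = k + 1 + s`. Their leading index `3k + 3 + s` is at
-- least `2k + 6` because `3 ≤ k`, so `P` has its final value there.
wrapped : ∀ {k P} → 3 ≤ k → Solution k P → ∀ s → s < 4 →
          P (suc k + (suc k + 4)) ℚ.+ P (suc k + suc s) ≡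
          P (suc k + (suc k + s)) ℚ.+ P (suc k + (suc k + suc s))
wrapped {k} {P} 3≤k sol s s<4 = begin
  d 4 ℚ.+ P (suc k + suc s)              ≡⟨ sym beyond ⊕ cong P (ℕₚ.+-suc (suc k) s) ⟩
  d (suc k + s) ℚ.+ P (suc (suc k + s))  ≡⟨ late (suc k + s) bound ⟩
  d s ℚ.+ P (suc k + suc (suc k + s))    ≡⟨ cong (λ m → d s ℚ.+ P (suc k + m)) (ℕₚ.+-suc (suc k) s) ⟨
  d s ℚ.+ d (suc s)                      ∎
  where
  open ≡-Reasoning
  open Solution sol
  d : ℕ → ℚ
  d r = P (suc k + (suc k + r))
  beyond : d (suc k + s) ≡ d 4
  -- `final` wants an offset of the form `4 + r`; here `k + 1 + s = 4 + (k - 3 + s)`.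
  beyond = subst (λ m → d m ≡ d 4) (cong (λ m → suc (m + s)) (ℕₚ.m+[n∸m]≡n 3≤k)) (final (k ∸ 3 + s))
  bound : suc k + s < 5 + k
  bound = subst (suc k + s <_) (cong suc (ℕₚ.+-comm k 4)) (ℕₚ.+-monoʳ-< (suc k) s<4)

module Forcing {k P} (3≤k : 3 ≤ k) (sol : Solution k P) where
  open Solution sol
  private
    d : ℕ → ℚ
    d r = P (suc k + (suc k + r))
  open Forced {d₀ = d 0} {d 1} {d 2} {d 3} {d 4} origin
    (early 0 z≤n) (early 1 (ℕₚ.≤-trans (ℕₚ.m≤n+m 1 2) 3≤k))
    (early 2 (ℕₚ.≤-trans (ℕₚ.m≤n+m 2 1) 3≤k)) (early 3 3≤k)
    (late 0 (ℕₚ.m≤m+n 1 (4 + k))) (late 1 (ℕₚ.m≤m+n 2 (3 + k)))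
    (late 2 (ℕₚ.m≤m+n 3 (2 + k))) (late 3 (ℕₚ.m≤m+n 4 (1 + k)))
    (wrapped 3≤k sol 0 (ℕₚ.m≤m+n 1 3)) (wrapped 3≤k sol 1 (ℕₚ.m≤m+n 2 2))
    (wrapped 3≤k sol 2 (ℕₚ.m≤m+n 3 1)) (wrapped 3≤k sol 3 ℕₚ.≤-refl) public

-- The sequence of period 3

cycle : ℚ → ℚ → ℕ → ℚ
cycle u v 0                   = 0ℚ
cycle u v 1                   = u
cycle u v 2                   = v
cycle u v (suc (suc (suc m))) = cycle u v m

cycle-sum : ∀ u v m → cycle u v m ℚ.+ cycle u v (1 + m) ℚ.+ cycle u v (2 + m) ≡ u ℚ.+ v
cycle-sum u v 0 = cong (ℚ._+ v) (ℚₚ.+-identityˡ u)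
cycle-sum u v 1 = ℚₚ.+-identityʳ (u ℚ.+ v)
cycle-sum u v 2 = lemma u v
  where
  lemma : ∀ u v → v ℚ.+ 0ℚ ℚ.+ u ≡ u ℚ.+ v
  lemma u v = solve (u ∷ v ∷ []) ℚ-ring
cycle-sum u v (suc (suc (suc m))) = cycle-sum u v m

cycle-zero : ∀ m → cycle 0ℚ 0ℚ m ≡ 0ℚ
cycle-zero 0 = refl
cycle-zero 1 = refl
cycle-zero 2 = refl
cycle-zero (suc (suc (suc m))) = cycle-zero m

[3+m]%3≡m%3 : ∀ m → (3 + m) % 3 ≡ m % 3
[3+m]%3≡m%3 m = trans (cong (_% 3) (ℕₚ.+-comm 3 m)) ([m+n]%n≡m%n m 3)

-- For `k = 4 + g`, `1 + g` is `k` modulo 3, and the two equations are `P k = 0` and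
-- `P (k + 1) = P 1`. When `g` is 1 or 2 modulo 3 they equate `u`, `v` and 0.
cycle-collapse : ∀ u v g → (1 + g) % 3 ≢ 1 →
                 cycle u v g ≡ 0ℚ → cycle u v (1 + g) ≡ u → u ≡ 0ℚ × v ≡ 0ℚ
cycle-collapse u v 0 ≢1 _   _   = ⊥-elim (≢1 refl)
cycle-collapse u v 1 _  u≡0 v≡u = u≡0 , trans v≡u u≡0
cycle-collapse u v 2 _  v≡0 0≡u = sym 0≡u , v≡0
cycle-collapse u v (suc (suc (suc g))) ≢1 =
  cycle-collapse u v g (λ ≡1 → ≢1 (trans ([3+m]%3≡m%3 (1 + g)) ≡1))

cycle-return : ∀ u v g → (1 + g) % 3 ≡ 1 →
               cycle u v (1 + g) ≡ u × cycle u v (2 + g) ≡ v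
cycle-return u v 0 _ = refl , refl
cycle-return u v 1 ()
cycle-return u v 2 ()
cycle-return u v (suc (suc (suc g))) ≡1 =
  cycle-return u v g (trans (sym ([3+m]%3≡m%3 (1 + g))) ≡1)

-- The pattern forced for k ≥ 4

module _ {g P} (sol : Solution (4 + g) P) where
  open Solution sol
  open Forcing (ℕₚ.m≤m+n 3 (1 + g)) sol

  private
    k : ℕ
    k = 4 + g

  P₁₊ₖ≡P₁ : P (suc k) ≡ P 1
  P₁₊ₖ≡P₁ = subst (λ m → P m ≡ P 1) (ℕₚ.+-identityʳ (suc k)) b₀≡a₁

  P₅≡P₁ : P 5 ≡ P 1
  P₅≡P₁ = lemma (P 4) (P 5) (early 4 (ℕₚ.m≤m+n 4 g)) a₄≡0 b₄≡a₁
    where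
    lemma : ∀ {a₁ b₄} a₄ a₅ → b₄ ≡ a₄ ℚ.+ a₅ → a₄ ≡ 0ℚ → b₄ ≡ a₁ → a₅ ≡ a₁
    lemma {a₁} {b₄} a₄ a₅ p q r = from-hypotheses (sym p ⊕ sym q ⊕ r) (solve (a₁ ∷ a₄ ∷ a₅ ∷ b₄ ∷ []) ℚ-ring)

  -- In `late k` the leading term `P (3k + 2)` is the final value `P 1 + P 2`, which is also
  -- `P (2k + 2)`. Cancelling leaves `P (k + 1) = P (2k + 1)`, and `early k` expands the right side
  -- to `P k + P (k + 1)`.
  Pₖ≡0 : P k ≡ 0ℚ
  Pₖ≡0 = lemma (P k) (P (suc k)) (P (suc k + k)) (P (suc k + suc k)) (late k (ℕₚ.m≤n+m (suc k) 4)) (final g) t≡a₁+a₂ (early k ℕₚ.≤-refl)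
               (trans (cong (λ m → P (suc k + m)) (sym (ℕₚ.+-identityʳ (suc k)))) d₀≡a₁+a₂)
    where
    lemma : ∀ {t t′ s} aₖ aₖ₊₁ bₖ bₖ₊₁ → t′ ℚ.+ aₖ₊₁ ≡ bₖ ℚ.+ bₖ₊₁ → t′ ≡ t → t ≡ s →
            bₖ ≡ aₖ ℚ.+ aₖ₊₁ → bₖ₊₁ ≡ s → aₖ ≡ 0ℚ
    lemma {t} {t′} {s} a a′ b b′ h₁ h₂ h₃ h₄ h₅ = sym (from-hypotheses
      (h₁ ⊕ sym h₂ ⊕ sym h₃ ⊕ h₄ ⊕ h₅)
      (solve (t ∷ t′ ∷ s ∷ a ∷ a′ ∷ b ∷ b′ ∷ []) ℚ-ring))

  -- Row `late (4 + j)` starts with the final value; expanding its right side by `early` yields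
  -- `P (5 + j)` twice, and one copy cancels.
  consecutive-sum : ∀ j → j < g → P (4 + j) ℚ.+ P (5 + j) ℚ.+ P (6 + j) ≡ P 1 ℚ.+ P 2
  consecutive-sum j j<g =
    lemma (P (4 + j)) (P (5 + j)) (P (6 + j)) (P (suc k + (4 + j))) (P (suc k + (5 + j)))
          (late (4 + j) (ℕₚ.+-monoʳ-< 4 (ℕₚ.≤-trans j<g (ℕₚ.m≤n+m g 5)))) (final j) t≡a₁+a₂
          (early (4 + j) (ℕₚ.+-monoʳ-≤ 4 (ℕₚ.<⇒≤ j<g))) (early (5 + j) (ℕₚ.+-monoʳ-≤ 4 j<g))
    where
    lemma : ∀ {t t′ s} p q r b b′ → t′ ℚ.+ q ≡ b ℚ.+ b′ → t′ ≡ t → t ≡ s →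
            b ≡ p ℚ.+ q → b′ ≡ q ℚ.+ r → p ℚ.+ q ℚ.+ r ≡ s
    lemma {t} {t′} {s} p q r b b′ h₁ h₂ h₃ h₄ h₅ = from-hypotheses
      (sym h₁ ⊕ h₂ ⊕ h₃ ⊕ sym h₄ ⊕ sym h₅)
      (solve (t ∷ t′ ∷ s ∷ p ∷ q ∷ r ∷ b ∷ b′ ∷ []) ℚ-ring)

  -- Two neighbouring values are carried along, since with the constant three-term sum they
  -- determine the next one.
  periodic : ∀ j → j ≤ g → P (4 + j) ≡ cycle (P 1) (P 2) j × P (5 + j) ≡ cycle (P 1) (P 2) (1 + j)
  periodic zero    _   = a₄≡0 , P₅≡P₁
  periodic (suc j) j<g with periodic j (ℕₚ.<⇒≤ j<g)
  ... | p , q = q , lemma (P (6 + j)) (cycle (P 1) (P 2) (2 + j)) (consecutive-sum j j<g) (cycle-sum (P 1) (P 2) j) p q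
    where
    lemma : ∀ {p q p′ q′ s} r r′ → p ℚ.+ q ℚ.+ r ≡ s → p′ ℚ.+ q′ ℚ.+ r′ ≡ s → p ≡ p′ → q ≡ q′ → r ≡ r′
    lemma {p} {q} {p′} {q′} {s} r r′ h₁ h₂ h₃ h₄ = from-hypotheses
      (h₁ ⊕ sym h₂ ⊕ sym h₃ ⊕ sym h₄)
      (solve (p ∷ q ∷ r ∷ p′ ∷ q′ ∷ r′ ∷ s ∷ []) ℚ-ring)

P₁≡P₂≡0 : ∀ {k P} → 3 ≤ k → Solution k P → k % 3 ≢ 1 → P 1 ≡ 0ℚ × P 2 ≡ 0ℚ
P₁≡P₂≡0 {1} (s≤s ())
P₁≡P₂≡0 {2} (s≤s (s≤s ()))
-- For `k = 3` the values overlap: `b₀` and `a₄` are both `P 4`, and `d₀` and `b₄` are both `P 8`.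
P₁≡P₂≡0 {3} {P} 3≤3 sol _ = P₁≡0 , lemma (P 2) d₀≡a₁+a₂ b₄≡a₁
  where
  open Forcing 3≤3 sol
  P₁≡0 : P 1 ≡ 0ℚ
  P₁≡0 = trans (sym b₀≡a₁) a₄≡0
  lemma : ∀ {a d} b → d ≡ a ℚ.+ b → d ≡ a → b ≡ 0ℚ
  lemma {a} {d} b p q = from-hypotheses (sym p ⊕ q) (solve (a ∷ b ∷ d ∷ []) ℚ-ring)
P₁≡P₂≡0 {suc (suc (suc (suc g)))} {P} _ sol ≢1 with periodic sol g ℕₚ.≤-refl
... | p , q = cycle-collapse (P 1) (P 2) g (λ ≡1 → ≢1 (trans ([3+m]%3≡m%3 (1 + g)) ≡1))
                (trans (sym p) (Pₖ≡0 sol)) (trans (sym q) (P₁₊ₖ≡P₁ sol))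

-- A solution is determined by P 1 and P 2

vanishing-start : ∀ {k P} → 3 ≤ k → Solution k P → P 1 ≡ 0ℚ → P 2 ≡ 0ℚ →
                  ∀ m → m ≤ suc k → P m ≡ 0ℚ
vanishing-start 3≤k sol p₁ p₂ 0 _ = Solution.origin sol
vanishing-start 3≤k sol p₁ p₂ 1 _ = p₁
vanishing-start 3≤k sol p₁ p₂ 2 _ = p₂
vanishing-start 3≤k sol p₁ p₂ 3 _ = Forcing.a₃≡0 3≤k sol
vanishing-start 3≤k sol p₁ p₂ 4 _ = Forcing.a₄≡0 3≤k sol
vanishing-start {P = P} 3≤k sol p₁ p₂ (suc (suc (suc (suc (suc j))))) (s≤s (s≤s (s≤s (s≤s (s≤s j≤g))))) = begin
  P (5 + j)                    ≡⟨ proj₂ (periodic sol j j≤g) ⟩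
  cycle (P 1) (P 2) (1 + j)    ≡⟨ cong₂ (λ u v → cycle u v (1 + j)) p₁ p₂ ⟩
  cycle 0ℚ 0ℚ (1 + j)          ≡⟨ cycle-zero (1 + j) ⟩
  0ℚ                           ∎
  where open ≡-Reasoning

-- Strong induction: past `k + 1` the recurrence expresses each value through earlier ones. By
-- linearity, `P 1` and `P 2` determine a solution, which bounds the nullity by 2.
vanishing : ∀ {k P} → 3 ≤ k → Solution k P → P 1 ≡ 0ℚ → P 2 ≡ 0ℚ → ∀ m → P m ≡ 0ℚ
vanishing {k} {P} 3≤k sol p₁ p₂ = <-rec (λ m → P m ≡ 0ℚ) body
  where
  open Solution sol
  1<1+k : 1 < suc k
  1<1+k = s≤s (ℕₚ.≤-trans (s≤s z≤n) 3≤k)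
  lemma : ∀ {p} q → p ℚ.+ q ≡ 0ℚ → q ≡ 0ℚ → p ≡ 0ℚ
  lemma {p} q h₁ h₂ = from-hypotheses (h₁ ⊕ sym h₂) (solve (p ∷ q ∷ []) ℚ-ring)
  beyond : ∀ i → (∀ {m} → m < suc k + i → P m ≡ 0ℚ) → 1 ≤ i → P (suc k + i) ≡ 0ℚ
  beyond i rec 1≤i with ≤-or-beyond k i
  ... | inj₁ i≤k = trans (early i i≤k)
          (rec (ℕₚ.m<n+m i (s≤s z≤n)) ⊕ rec (ℕₚ.+-monoˡ-< i 1<1+k))
  ... | inj₂ (r , refl) with ≤-or-beyond (4 + k) r
  -- `late r` is solved for its largest index `2k + 2 + r`.
  ...   | inj₁ r≤4+k = lemma (P (suc r))
            (trans (late r (s≤s r≤4+k))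
                   (rec (ℕₚ.+-monoʳ-< (suc k) (ℕₚ.m<n+m r (s≤s z≤n)))
                    ⊕ rec (ℕₚ.+-monoʳ-< (suc k) (ℕₚ.+-monoˡ-< r 1<1+k))))
            (rec (ℕₚ.<-≤-trans (ℕₚ.+-monoˡ-< r 1<1+k) (ℕₚ.m≤n+m (suc k + r) (suc k))))
  -- Past `2k + 6`, `final` leads back to the smaller index `2k + 6`.
  ...   | inj₂ (s , refl) = trans (final (suc k + s))
            (rec (ℕₚ.+-monoʳ-< (suc k) (ℕₚ.+-monoʳ-< (suc k) (ℕₚ.m≤m+n 5 (k + s)))))
  body : ∀ m → (∀ {m′} → m′ < m → P m′ ≡ 0ℚ) → P m ≡ 0ℚ
  body m rec with ≤-or-beyond k m
  ... | inj₁ m≤k           = vanishing-start 3≤k sol p₁ p₂ m (ℕₚ.m≤n⇒m≤1+n m≤k)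
  ... | inj₂ (zero  , refl) = vanishing-start 3≤k sol p₁ p₂ m (ℕₚ.≤-reflexive (ℕₚ.+-identityʳ (suc k)))
  ... | inj₂ (suc i , refl) = beyond (suc i) rec (s≤s z≤n)

-- The solutions for k ≡ 1 (mod 3)

-- Recursion on the length, instead of a comparison, makes initial values such as `P 0`, `P 1`,
-- `P 2` in `Construction` reduce; later proofs compute with them.
splice : ∀ {X : Set} → ℕ → (ℕ → X) → (ℕ → X) → ℕ → X
splice zero    f h m       = h m
splice (suc l) f h zero    = f zero
splice (suc l) f h (suc m) = splice l (f ∘ suc) h m

splice-< : ∀ {X : Set} l (f h : ℕ → X) {m} → m < l → splice l f h m ≡ f m
splice-< (suc l) f h {zero}  _         = refl
splice-< (suc l) f h {suc m} (s≤s m<l) = splice-< l (f ∘ suc) h m<l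

splice-+ : ∀ {X : Set} l (f h : ℕ → X) m → splice l f h (l + m) ≡ h m
splice-+ zero    f h m = refl
splice-+ (suc l) f h m = splice-+ l (f ∘ suc) h m

module Construction (u v : ℚ) (g : ℕ) (k≡1 : (1 + g) % 3 ≡ 1) where
  private
    k : ℕ
    k = 4 + g

  -- P on [0, k + 1], then P (k + 1 + _) on [0, k + 1], then P (2k + 3 + _), as
  -- forced by P 1 = u and P 2 = v.
  lower middle upper P : ℕ → ℚ

  lower 0 = 0ℚ
  lower 1 = u
  lower 2 = v
  lower 3 = 0ℚ
  lower (suc (suc (suc (suc m)))) = cycle u v m

  middle m = lower m ℚ.+ lower (suc m)

  upper 0 = u ℚ.+ v
  upper 1 = v
  upper 2 = u
  upper (suc (suc (suc m))) = u ℚ.+ v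

  P = splice (suc k) lower (splice (2 + k) middle upper)

  P-middle : ∀ m → m ≤ suc k → P (suc k + m) ≡ middle m
  P-middle m m≤ = trans (splice-+ (suc k) lower _ m) (splice-< (2 + k) middle upper (s≤s m≤))

  P-upper : ∀ m → P (suc k + (suc k + suc m)) ≡ upper m
  P-upper m = trans (splice-+ (suc k) lower _ (suc k + suc m))
    (trans (cong (splice (2 + k) middle upper) (ℕₚ.+-suc (suc k) m)) (splice-+ (2 + k) middle upper m))

  -- At `m = suc k` the splice already reads `middle 0 = u`. It agrees with `lower (suc k)` because
  -- `g` is a multiple of 3; here the congruence on `k` enters.
  P-lower : ∀ m → m ≤ suc k → P m ≡ lower m
  P-lower m m≤ with ℕₚ.m≤n⇒m<n∨m≡n m≤
  ... | inj₁ m<   = splice-< (suc k) lower _ m<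
  ... | inj₂ refl = begin
    P (suc k)        ≡⟨ cong P (ℕₚ.+-identityʳ (suc k)) ⟨
    P (suc k + 0)    ≡⟨ P-middle 0 z≤n ⟩
    0ℚ ℚ.+ u         ≡⟨ ℚₚ.+-identityˡ u ⟩
    u                ≡⟨ proj₁ (cycle-return u v g k≡1) ⟨
    lower (suc k)    ∎
    where open ≡-Reasoning

  P-top : P (suc k + (suc k + 0)) ≡ u ℚ.+ v
  P-top = begin
    P (suc k + (suc k + 0))  ≡⟨ cong (λ m → P (suc k + m)) (ℕₚ.+-identityʳ (suc k)) ⟩
    P (suc k + suc k)        ≡⟨ P-middle (suc k) ℕₚ.≤-refl ⟩
    -- `lower (2 + k)` is not `P (2 + k)`, but continuing the cycle one step gives it the value `v`
    -- needed here.
    middle (suc k)           ≡⟨ proj₁ (cycle-return u v g k≡1) ⊕ proj₂ (cycle-return u v g k≡1) ⟩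
    u ℚ.+ v                  ∎
    where open ≡-Reasoning

  private
    edge-1 : ∀ u v → u ℚ.+ v ℚ.+ (v ℚ.+ 0ℚ) ≡ u ℚ.+ v ℚ.+ v
    edge-1 u v = solve (u ∷ v ∷ []) ℚ-ring
    edge-2 : ∀ u v → u ℚ.+ v ℚ.+ (0ℚ ℚ.+ 0ℚ) ≡ v ℚ.+ u
    edge-2 u v = solve (u ∷ v ∷ []) ℚ-ring
    edge-3 : ∀ u v → u ℚ.+ v ℚ.+ (0ℚ ℚ.+ u) ≡ u ℚ.+ (u ℚ.+ v)
    edge-3 u v = solve (u ∷ v ∷ []) ℚ-ring

  -- The last four rows, as in `wrapped`, with `u + v` in place of the final value.
  late-edge : ∀ s → s < 4 →
    u ℚ.+ v ℚ.+ P (suc k + suc s) ≡ P (suc k + (suc k + s)) ℚ.+ P (suc k + (suc k + suc s))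
  late-edge 0 _ = trans (cong (u ℚ.+ v ℚ.+_) (P-middle 1 (ℕₚ.m≤m+n 1 (4 + g))))
    (sym (P-top ⊕ P-upper 0))
  late-edge 1 _ = trans (cong (u ℚ.+ v ℚ.+_) (P-middle 2 (ℕₚ.m≤m+n 2 (3 + g))))
    (trans (edge-1 u v) (sym (P-upper 0 ⊕ P-upper 1)))
  late-edge 2 _ = trans (cong (u ℚ.+ v ℚ.+_) (P-middle 3 (ℕₚ.m≤m+n 3 (2 + g))))
    (trans (edge-2 u v) (sym (P-upper 1 ⊕ P-upper 2)))
  late-edge 3 _ = trans (cong (u ℚ.+ v ℚ.+_) (P-middle 4 (ℕₚ.m≤m+n 4 (1 + g))))
    (trans (edge-3 u v) (sym (P-upper 2 ⊕ P-upper 3)))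
  late-edge (suc (suc (suc (suc s)))) (s≤s (s≤s (s≤s (s≤s ()))))

  solution : Solution k P
  solution = record { origin = refl ; early = early ; late = late ; final = final }
    where
    open ≡-Reasoning

    early : ∀ i → i ≤ k → P (suc k + i) ≡ P i ℚ.+ P (suc i)
    early i i≤k = trans (P-middle i (ℕₚ.m≤n⇒m≤1+n i≤k))
                        (sym (P-lower i (ℕₚ.m≤n⇒m≤1+n i≤k) ⊕ P-lower (suc i) (s≤s i≤k)))

    final : ∀ r → P (suc k + (suc k + (4 + r))) ≡ P (suc k + (suc k + 4))
    final r = trans (P-upper (3 + r)) (sym (P-upper 3))

    late : ∀ r → r < 5 + k →
      P (suc k + (suc k + r)) ℚ.+ P (suc r) ≡ P (suc k + r) ℚ.+ P (suc k + suc r)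
    late 0 _ = begin
      _                    ≡⟨ P-top ⊕ P-lower 1 (ℕₚ.m≤m+n 1 (4 + g)) ⟩
      u ℚ.+ v ℚ.+ u        ≡⟨ solve (u ∷ v ∷ []) ℚ-ring ⟩
      (0ℚ ℚ.+ u) ℚ.+ (u ℚ.+ v) ≡⟨ P-middle 0 z≤n ⊕ P-middle 1 (ℕₚ.m≤m+n 1 (4 + g)) ⟨
      _                    ∎
    late 1 _ = begin
      _                    ≡⟨ P-upper 0 ⊕ P-lower 2 (ℕₚ.m≤m+n 2 (3 + g)) ⟩
      u ℚ.+ v ℚ.+ v        ≡⟨ solve (u ∷ v ∷ []) ℚ-ring ⟩
      (u ℚ.+ v) ℚ.+ (v ℚ.+ 0ℚ) ≡⟨ P-middle 1 (ℕₚ.m≤m+n 1 (4 + g)) ⊕ P-middle 2 (ℕₚ.m≤m+n 2 (3 + g)) ⟨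
      _                    ∎
    late 2 _ = begin
      _                    ≡⟨ P-upper 1 ⊕ P-lower 3 (ℕₚ.m≤m+n 3 (2 + g)) ⟩
      v ℚ.+ 0ℚ             ≡⟨ solve (v ∷ []) ℚ-ring ⟩
      (v ℚ.+ 0ℚ) ℚ.+ (0ℚ ℚ.+ 0ℚ) ≡⟨ P-middle 2 (ℕₚ.m≤m+n 2 (3 + g)) ⊕ P-middle 3 (ℕₚ.m≤m+n 3 (2 + g)) ⟨
      _                    ∎
    late 3 _ = begin
      _                    ≡⟨ P-upper 2 ⊕ P-lower 4 (ℕₚ.m≤m+n 4 (1 + g)) ⟩
      u ℚ.+ 0ℚ             ≡⟨ solve (u ∷ []) ℚ-ring ⟩
      (0ℚ ℚ.+ 0ℚ) ℚ.+ (0ℚ ℚ.+ u) ≡⟨ P-middle 3 (ℕₚ.m≤m+n 3 (2 + g)) ⊕ P-middle 4 (ℕₚ.m≤m+n 4 (1 + g)) ⟨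
      _                    ∎
    -- From `r = 4` on, the leading term is `u + v`. For `r ≤ k` the row reduces to `cycle-sum`; the
    -- other rows are those of `late-edge`.
    late (suc (suc (suc (suc j)))) r<5+k with ≤-or-beyond k (4 + j)
    ... | inj₁ r≤k = begin
      _                              ≡⟨ P-upper (3 + j) ⊕ P-lower (5 + j) (s≤s r≤k) ⟩
      u ℚ.+ v ℚ.+ lower (5 + j)      ≡⟨ lemma (cycle u v j) (cycle u v (1 + j)) (cycle u v (2 + j)) (cycle-sum u v j) ⟩
      middle (4 + j) ℚ.+ middle (5 + j)
        ≡⟨ P-middle (4 + j) (ℕₚ.m≤n⇒m≤1+n r≤k) ⊕ P-middle (5 + j) (s≤s r≤k) ⟨
      _                              ∎
      where
      lemma : ∀ {s} p q r → p ℚ.+ q ℚ.+ r ≡ s → s ℚ.+ q ≡ p ℚ.+ q ℚ.+ (q ℚ.+ r)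
      lemma p q r refl = solve (p ∷ q ∷ r ∷ []) ℚ-ring
    ... | inj₂ (s , r≡1+k+s) = begin
      P (suc k + (suc k + (4 + j))) ℚ.+ P (5 + j)
        ≡⟨ P-upper (3 + j) ⊕ cong P 5+j≡ ⟩
      u ℚ.+ v ℚ.+ P (suc k + suc s)
        ≡⟨ late-edge s s<4 ⟩
      P (suc k + (suc k + s)) ℚ.+ P (suc k + (suc k + suc s))
        ≡⟨ cong₂ (λ m m′ → P (suc k + m) ℚ.+ P (suc k + m′)) r≡1+k+s 5+j≡ ⟨
      P (suc k + (4 + j)) ℚ.+ P (suc k + (5 + j)) ∎
      where
      5+j≡ : 5 + j ≡ suc k + suc s
      5+j≡ = trans (cong suc r≡1+k+s) (sym (ℕₚ.+-suc (suc k) s))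
      s<4 : s < 4
      s<4 = ℕₚ.+-cancelˡ-< (suc k) s 4
        (subst₂ _<_ r≡1+k+s (cong suc (ℕₚ.+-comm 4 k)) r<5+k)

-- Nullities

nullity-zero : ∀ k → 3 ≤ k → k % 3 ≢ 1 → HasNullity (A (2 * k + 6) k) 0
nullity-zero k 3≤k k≢1 = record
  { basis       = λ ()
  ; inKernel    = λ ()
  ; independent = λ _ _ ()
  ; spanning    = λ x Ax≡0 → record { coefficients = λ () ; equation = kernel-trivial x Ax≡0 }
  }
  where
  kernel-trivial : ∀ x → InKernel (A (2 * k + 6) k) x → ∀ j → x j ≡ 0ℚ
  kernel-trivial x Ax≡0 j = lemma (partialSum-suc x j) (P≡0 (suc (toℕ j))) (P≡0 (toℕ j))
    where
    sol : Solution k (partialSum x)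
    sol = inKernel⇒solution k x Ax≡0
    P≡0 : ∀ m → partialSum x m ≡ 0ℚ
    P≡0 with P₁≡P₂≡0 3≤k sol k≢1
    ... | p₁ , p₂ = vanishing 3≤k sol p₁ p₂
    lemma : ∀ {x p q} → p ≡ x ℚ.+ q → p ≡ 0ℚ → q ≡ 0ℚ → x ≡ 0ℚ
    lemma {x} h refl refl = trans (sym (ℚₚ.+-identityʳ x)) (sym h)

nullity-two : ∀ g → (1 + g) % 3 ≡ 1 → HasNullity (A (2 * (4 + g) + 6) (4 + g)) 2
nullity-two g k≡1 = record
  { basis       = basis
  ; inKernel    = λ { Fin.zero           → solution⇒inKernel k U.P U.solution
                    ; (Fin.suc Fin.zero) → solution⇒inKernel k V.P V.solution }
  ; independent = independent
  ; spanning    = spanning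
  }
  where
  k n : ℕ
  k = 4 + g
  n = 2 * k + 6
  -- The solutions with `(P 1, P 2)` equal to `(1, 0)` and `(0, 1)`.
  module U = Construction 1ℚ 0ℚ g k≡1
  module V = Construction 0ℚ 1ℚ g k≡1

  basis : Fin 2 → Vector ℚ n
  basis Fin.zero           = increments n U.P
  basis (Fin.suc Fin.zero) = increments n V.P

  independent : LinearlyIndependent basis
  independent c c≡0 = λ { Fin.zero → c₀≡0 ; (Fin.suc Fin.zero) → c₁≡0 }
    where
    -- The first two coordinates of the basis vectors are `1, -1` and `0, 1`, a triangular system
    -- for `c`.
    first : ∀ a b → a ℚ.* 1ℚ ℚ.+ (b ℚ.* 0ℚ ℚ.+ 0ℚ) ≡ a
    first a b = solve (a ∷ b ∷ []) ℚ-ring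
    second : ∀ a b → a ℚ.* (ℚ.- 1ℚ) ℚ.+ (b ℚ.* 1ℚ ℚ.+ 0ℚ) ℚ.+ a ≡ b
    second a b = solve (a ∷ b ∷ []) ℚ-ring
    c₀≡0 : c Fin.zero ≡ 0ℚ
    c₀≡0 = trans (sym (first (c Fin.zero) (c (Fin.suc Fin.zero)))) (c≡0 Fin.zero)
    c₁≡0 : c (Fin.suc Fin.zero) ≡ 0ℚ
    c₁≡0 = trans (sym (second (c Fin.zero) (c (Fin.suc Fin.zero)))) (c≡0 (Fin.suc Fin.zero) ⊕ c₀≡0)

  spanning : ∀ x → InKernel (A n k) x → Spans basis x
  spanning x Ax≡0 = record
    { coefficients = λ { Fin.zero → S 1 ; (Fin.suc Fin.zero) → S 2 }
    ; equation     = λ j → equation (S 1) (S 2) (S (suc (toℕ j))) (S (toℕ j)) (x j)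
        (U.P (suc (toℕ j))) (U.P (toℕ j)) (V.P (suc (toℕ j))) (V.P (toℕ j))
        (partialSum-suc x j) (remainder≡0 (suc (toℕ j))) (remainder≡0 (toℕ j))
    }
    where
    S remainder : ℕ → ℚ
    S = partialSum x
    -- Subtracting the combination with the same `P 1` and `P 2` leaves a solution to which
    -- `vanishing` applies. The factors `1ℚ` and `- 1ℚ` match the form of `linear-combination`.
    remainder m = 1ℚ ℚ.* S m ℚ.+ (ℚ.- 1ℚ) ℚ.* (S 1 ℚ.* U.P m ℚ.+ S 2 ℚ.* V.P m)
    at-1 : ∀ a b → 1ℚ ℚ.* a ℚ.+ (ℚ.- 1ℚ) ℚ.* (a ℚ.* 1ℚ ℚ.+ b ℚ.* 0ℚ) ≡ 0ℚ
    at-1 a b = solve (a ∷ b ∷ []) ℚ-ring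
    at-2 : ∀ a b → 1ℚ ℚ.* b ℚ.+ (ℚ.- 1ℚ) ℚ.* (a ℚ.* 0ℚ ℚ.+ b ℚ.* 1ℚ) ≡ 0ℚ
    at-2 a b = solve (a ∷ b ∷ []) ℚ-ring
    remainder≡0 : ∀ m → remainder m ≡ 0ℚ
    remainder≡0 = vanishing (ℕₚ.m≤m+n 3 (1 + g))
      (linear-combination 1ℚ (ℚ.- 1ℚ) (inKernel⇒solution k x Ax≡0)
        (linear-combination (S 1) (S 2) U.solution V.solution))
      (at-1 (S 1) (S 2)) (at-2 (S 1) (S 2))
    equation : ∀ a b s s′ xⱼ p p′ q q′ → s ≡ xⱼ ℚ.+ s′ →
      1ℚ ℚ.* s ℚ.+ (ℚ.- 1ℚ) ℚ.* (a ℚ.* p ℚ.+ b ℚ.* q) ≡ 0ℚ →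
      1ℚ ℚ.* s′ ℚ.+ (ℚ.- 1ℚ) ℚ.* (a ℚ.* p′ ℚ.+ b ℚ.* q′) ≡ 0ℚ →
      xⱼ ≡ a ℚ.* (p ℚ.- p′) ℚ.+ (b ℚ.* (q ℚ.- q′) ℚ.+ 0ℚ)
    equation a b s s′ xⱼ p p′ q q′ h₁ h₂ h₃ = from-hypotheses (sym h₁ ⊕ h₂ ⊕ sym h₃)
      (solve (a ∷ b ∷ s ∷ s′ ∷ xⱼ ∷ p ∷ p′ ∷ q ∷ q′ ∷ []) ℚ-ring)

theorem8p6 : (k : ℕ) → k > 2 →
    (k % 3 ≡ 1 → HasNullity (A (2 * k + 6) k) 2) ×
    (k % 3 ≢ 1 → HasNullity (A (2 * k + 6) k) 0)
theorem8p6 k k>2 = two k k>2 , nullity-zero k k>2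
  where
  two : ∀ k → k > 2 → k % 3 ≡ 1 → HasNullity (A (2 * k + 6) k) 2
  two 1 (s≤s ())
  two 2 (s≤s (s≤s ()))
  two 3 _ ()
  two (suc (suc (suc (suc g)))) _ k≡1 = nullity-two g (trans (sym ([3+m]%3≡m%3 (1 + g))) k≡1)
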